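{- For all $a,N,M\in\mathbb{N}$ with $N\le M$, $$\frac{(-q^{2a};q^{2a})_{N+M-1}}{(-q^a;q^{2a})_N\,(q^a;q^{2a})_M}\in\mathbb{N}_0[[q]].$$
   Context: $\mathbb{N}$ is the set of positive integers and $\mathbb{N}_0=\mathbb{N}\cup\{0\}$. Notation: $(z;q)_n=\prod_{i=0}^{n-1}(1-zq^i)$. The quotient is expanded as a formal power series in $q$; $\mathbb{N}_0[[q]]$ is the set of power series with non-negative integer coefficients. -}

module Defs where

open import Data.Fin.Base using (toℕ)
open import Data.Integer.Base using (ℤ; 0ℤ; 1ℤ; _+_; _-_; _*_; -_; _≤_)
open import Data.Integer.Properties
open import Data.Nat.Base as ℕ using (ℕ; zero; suc; _∸_; NonZero)
open import Algebra.Properties.Monoid.Sum +-0-monoid using (sum⁺-syntax)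
open import Relation.Binary.PropositionalEquality
  using (_≡_; refl; cong; cong₂; sym; trans; _≗_; module ≡-Reasoning)

infix  8 -ˢ_
infixr 9 _^ˢ_
infixl 7 _*ˢ_ _/ˢ_
infixl 6 _-ˢ_
infix  4 _∈ℕ₀[[q]]

-- ℤ[[q]]: the series Σₙ f(n) qⁿ is given by its coefficient function f.

ℤ[[q]] : Set
ℤ[[q]] = ℕ → ℤ

1ˢ : ℤ[[q]]
1ˢ zero    = 1ℤ
1ˢ (suc _) = 0ℤ

q : ℤ[[q]]
q zero          = 0ℤ
q (suc zero)    = 1ℤ
q (suc (suc _)) = 0ℤ

-ˢ_ : ℤ[[q]] → ℤ[[q]]
(-ˢ f) n = - f n

_-ˢ_ : ℤ[[q]] → ℤ[[q]] → ℤ[[q]]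
(f -ˢ g) n = f n - g n

_*ˢ_ : ℤ[[q]] → ℤ[[q]] → ℤ[[q]]
(f *ˢ g) n = ∑[ k ≤ n ] (f (toℕ k) * g (n ∸ toℕ k))

_^ˢ_ : ℤ[[q]] → ℕ → ℤ[[q]]
f ^ˢ zero  = 1ˢ
f ^ˢ suc n = f *ˢ f ^ˢ n

-- The quotient f / g for g with constant term 1, by long division: writing
-- f = f(0) g + q r gives f / g = f(0) + q (r / g).  It is meaningless for other
-- g; /ˢ-correct shows that it is the quotient when g(0) = 1.

_/ˢ_ : ℤ[[q]] → ℤ[[q]] → ℤ[[q]]
(f /ˢ g) zero    = f 0
(f /ˢ g) (suc n) = ((λ m → f (suc m) - f 0 * g (suc m)) /ˢ g) n

-- (z ; p)ₙ = ∏_{0 ≤ i < n} (1 - z pⁱ)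

⟨_⨾_⟩_ : ℤ[[q]] → ℤ[[q]] → ℕ → ℤ[[q]]
⟨ z ⨾ p ⟩ zero  = 1ˢ
⟨ z ⨾ p ⟩ suc n = (⟨ z ⨾ p ⟩ n) *ˢ (1ˢ -ˢ z *ˢ p ^ˢ n)

_∈ℕ₀[[q]] : ℤ[[q]] → Set
f ∈ℕ₀[[q]] = ∀ n → 0ℤ ≤ f n

/ˢ-correct : ∀ f g → g 0 ≡ 1ℤ → (f /ˢ g) *ˢ g ≗ f
/ˢ-correct f g g₀ zero = begin
  f 0 * g 0 + 0ℤ  ≡⟨ +-identityʳ _ ⟩
  f 0 * g 0       ≡⟨ cong (f 0 *_) g₀ ⟩
  f 0 * 1ℤ        ≡⟨ *-identityʳ _ ⟩
  f 0             ∎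
  where open ≡-Reasoning
/ˢ-correct f g g₀ (suc n) = begin
  c + ((r /ˢ g) *ˢ g) n    ≡⟨ cong (λ x → c + x) (/ˢ-correct r g g₀ n) ⟩
  c + (f (suc n) - c)      ≡⟨ +-comm c _ ⟩
  f (suc n) - c + c        ≡⟨ +-assoc (f (suc n)) (- c) c ⟩
  f (suc n) + (- c + c)    ≡⟨ cong (λ x → f (suc n) + x) (+-inverseˡ c) ⟩
  f (suc n) + 0ℤ           ≡⟨ +-identityʳ _ ⟩
  f (suc n)                ∎
  where
  open ≡-Reasoning
  c = f 0 * g (suc n)
  r : ℤ[[q]]
  r m = f (suc m) - f 0 * g (suc m)

-- The denominators (-qᵃ ; q²ᵃ)_N (qᵃ ; q²ᵃ)_M do have constant term 1.

*ˢ-constant : ∀ f g → (f *ˢ g) 0 ≡ f 0 * g 0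
*ˢ-constant f g = +-identityʳ (f 0 * g 0)

q^-constant : ∀ a .{{_ : NonZero a}} → (q ^ˢ a) 0 ≡ 0ℤ
q^-constant (suc a) = *ˢ-constant q (q ^ˢ a)

⟨⟩-constant : ∀ z p n → z 0 ≡ 0ℤ → (⟨ z ⨾ p ⟩ n) 0 ≡ 1ℤ
⟨⟩-constant z p zero    z₀ = refl
⟨⟩-constant z p (suc n) z₀ = trans (*ˢ-constant (⟨ z ⨾ p ⟩ n) (1ˢ -ˢ z *ˢ p ^ˢ n))
  (cong₂ _*_ (⟨⟩-constant z p n z₀)
             (cong (λ x → 1ℤ - x) (trans (*ˢ-constant z (p ^ˢ n)) (cong (_* (p ^ˢ n) 0) z₀))))

denominator-constant : ∀ a N M .{{_ : NonZero a}} →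
  ((⟨ -ˢ q ^ˢ a ⨾ q ^ˢ (2 ℕ.* a) ⟩ N) *ˢ (⟨ q ^ˢ a ⨾ q ^ˢ (2 ℕ.* a) ⟩ M)) 0 ≡ 1ℤ
denominator-constant a N M = trans
  (*ˢ-constant (⟨ -ˢ q ^ˢ a ⨾ q ^ˢ (2 ℕ.* a) ⟩ N) (⟨ q ^ˢ a ⨾ q ^ˢ (2 ℕ.* a) ⟩ M))
  (cong₂ _*_ (⟨⟩-constant (-ˢ q ^ˢ a) (q ^ˢ (2 ℕ.* a)) N (cong (λ x → - x) (q^-constant a)))
             (⟨⟩-constant (q ^ˢ a) (q ^ˢ (2 ℕ.* a)) M (q^-constant a)))

{-# OPTIONS --safe #-}

-- Since N ≤ M, the denominator pairs up as ∏_{i<N} (1 - z_i²) ∏_{N≤i<M} (1 - z_i) with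
-- z_i = qᵃ q²ᵃⁱ.  Every factor 1 - y, with y having non-negative coefficients and no constant
-- term, has the inverse 1 + y + y² + ⋯ with non-negative coefficients, and every factor of the
-- numerator has non-negative coefficients.

module Submission where

open import Algebra.Bundles using (CommutativeRing)
import Algebra.Construct.Pointwise as Pointwise
import Algebra.Properties.CommutativeSemigroup as CommutativeSemigroupProperties
import Algebra.Properties.Ring as RingProperties
open import Data.Integer.Base as ℤ using (0ℤ; 1ℤ; +≤+; nonNegative)
import Data.Integer.Properties as ℤ
open import Data.Integer.Tactic.RingSolver using (solve-∀)
open import Data.Nat.Base
  using (ℕ; zero; suc; NonZero; _+_; _*_; _∸_; _≤_; z≤n; _≤′_; ≤′-refl; ≤′-step)
open import Data.Nat.Properties using (≤⇒≤′)
open import Data.Product.Base using (∃; _×_; _,_)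
open import Function.Base using (_∘_)
open import Level using (0ℓ)
open import Relation.Binary.PropositionalEquality
  using (_≡_; _≗_; refl; cong; cong₂; sym; trans; subst; module ≡-Reasoning)
import Relation.Binary.Reasoning.Setoid as SetoidReasoning

open import Defs

infixl 6 _+ˢ_

-- The ring of power series

0ˢ : ℤ[[q]]
0ˢ _ = 0ℤ

_+ˢ_ : ℤ[[q]] → ℤ[[q]] → ℤ[[q]]
(f +ˢ g) n = f n ℤ.+ g n

-- The inductions on products rest on the unfolding of `(f *ˢ g) (suc n)` to
-- `f 0 * g (suc n) + ((f ∘ suc) *ˢ g) n`, which holds by computation: the first factor is shifted
-- and the second stays fixed.
*ˢ-cong : ∀ {f f′ g g′} → f ≗ f′ → g ≗ g′ → f *ˢ g ≗ f′ *ˢ g′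
*ˢ-cong f≗f′ g≗g′ zero    = cong₂ (λ x y → x ℤ.* y ℤ.+ 0ℤ) (f≗f′ 0) (g≗g′ 0)
*ˢ-cong f≗f′ g≗g′ (suc n) =
  cong₂ ℤ._+_ (cong₂ ℤ._*_ (f≗f′ 0) (g≗g′ (suc n))) (*ˢ-cong (f≗f′ ∘ suc) g≗g′ n)

*ˢ-zeroˡ : ∀ f → 0ˢ *ˢ f ≗ 0ˢ
*ˢ-zeroˡ f zero    = refl
*ˢ-zeroˡ f (suc n) = trans (ℤ.+-identityˡ _) (*ˢ-zeroˡ f n)

*ˢ-identityˡ : ∀ f → 1ˢ *ˢ f ≗ f
*ˢ-identityˡ f zero    = trans (ℤ.+-identityʳ _) (ℤ.*-identityˡ _)
*ˢ-identityˡ f (suc n) = begin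
  1ℤ ℤ.* f (suc n) ℤ.+ (0ˢ *ˢ f) n  ≡⟨ cong₂ ℤ._+_ (ℤ.*-identityˡ (f (suc n))) (*ˢ-zeroˡ f n) ⟩
  f (suc n) ℤ.+ 0ℤ                  ≡⟨ ℤ.+-identityʳ _ ⟩
  f (suc n)                         ∎
  where open ≡-Reasoning

*ˢ-distribʳ-+ˢ : ∀ h f g → (f +ˢ g) *ˢ h ≗ f *ˢ h +ˢ g *ˢ h
*ˢ-distribʳ-+ˢ h f g zero    = lemma (f 0) (g 0) (h 0)
  where
  lemma : ∀ x y z → (x ℤ.+ y) ℤ.* z ℤ.+ 0ℤ ≡ (x ℤ.* z ℤ.+ 0ℤ) ℤ.+ (y ℤ.* z ℤ.+ 0ℤ)
  lemma = solve-∀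
*ˢ-distribʳ-+ˢ h f g (suc n) = trans
  (cong (λ t → (f 0 ℤ.+ g 0) ℤ.* h (suc n) ℤ.+ t) (*ˢ-distribʳ-+ˢ h (f ∘ suc) (g ∘ suc) n))
  (lemma (f 0) (g 0) (h (suc n)) _ _)
  where
  lemma : ∀ x y z s t →
    (x ℤ.+ y) ℤ.* z ℤ.+ (s ℤ.+ t) ≡ (x ℤ.* z ℤ.+ s) ℤ.+ (y ℤ.* z ℤ.+ t)
  lemma = solve-∀

*ˢ-scaleˡ : ∀ c f g → (λ m → c ℤ.* f m) *ˢ g ≗ λ m → c ℤ.* (f *ˢ g) m
*ˢ-scaleˡ c f g zero    = lemma c (f 0) (g 0)
  where
  lemma : ∀ x y z → x ℤ.* y ℤ.* z ℤ.+ 0ℤ ≡ x ℤ.* (y ℤ.* z ℤ.+ 0ℤ)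
  lemma = solve-∀
*ˢ-scaleˡ c f g (suc n) = trans
  (cong (λ t → c ℤ.* f 0 ℤ.* g (suc n) ℤ.+ t) (*ˢ-scaleˡ c (f ∘ suc) g n))
  (lemma c (f 0) (g (suc n)) _)
  where
  lemma : ∀ x y z t → x ℤ.* y ℤ.* z ℤ.+ x ℤ.* t ≡ x ℤ.* (y ℤ.* z ℤ.+ t)
  lemma = solve-∀

-- The tail of `f *ˢ g` is `f₀g⁺ +ˢ f⁺ *ˢ g`, so distributivity and `*ˢ-scaleˡ` reduce the claim at
-- `suc n` to the claim at `n` for `f⁺`.
*ˢ-assoc : ∀ f g h → (f *ˢ g) *ˢ h ≗ f *ˢ (g *ˢ h)
*ˢ-assoc f g h zero    = lemma (f 0) (g 0) (h 0)
  where
  lemma : ∀ x y z → (x ℤ.* y ℤ.+ 0ℤ) ℤ.* z ℤ.+ 0ℤ ≡ x ℤ.* (y ℤ.* z ℤ.+ 0ℤ) ℤ.+ 0ℤ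
  lemma = solve-∀
*ˢ-assoc f g h (suc n) = begin
  (f *ˢ g) 0 ℤ.* h (suc n) ℤ.+ ((f₀g⁺ +ˢ f⁺ *ˢ g) *ˢ h) n
    ≡⟨ cong₂ (λ s t → s ℤ.* h (suc n) ℤ.+ t) (*ˢ-constant f g) (*ˢ-distribʳ-+ˢ h f₀g⁺ (f⁺ *ˢ g) n) ⟩
  f 0 ℤ.* g 0 ℤ.* h (suc n) ℤ.+ ((f₀g⁺ *ˢ h) n ℤ.+ ((f⁺ *ˢ g) *ˢ h) n)
    ≡⟨ cong₂ (λ s t → f 0 ℤ.* g 0 ℤ.* h (suc n) ℤ.+ (s ℤ.+ t))
         (*ˢ-scaleˡ (f 0) (g ∘ suc) h n) (*ˢ-assoc f⁺ g h n) ⟩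
  f 0 ℤ.* g 0 ℤ.* h (suc n) ℤ.+ (f 0 ℤ.* ((g ∘ suc) *ˢ h) n ℤ.+ (f⁺ *ˢ (g *ˢ h)) n)
    ≡⟨ lemma (f 0) (g 0) (h (suc n)) _ _ ⟩
  f 0 ℤ.* (g 0 ℤ.* h (suc n) ℤ.+ ((g ∘ suc) *ˢ h) n) ℤ.+ (f⁺ *ˢ (g *ˢ h)) n
    ∎
  where
  open ≡-Reasoning
  f⁺ f₀g⁺ : ℤ[[q]]
  f⁺ = f ∘ suc
  f₀g⁺ m = f 0 ℤ.* g (suc m)
  lemma : ∀ x y z s t →
    x ℤ.* y ℤ.* z ℤ.+ (x ℤ.* s ℤ.+ t) ≡ x ℤ.* (y ℤ.* z ℤ.+ s) ℤ.+ t
  lemma = solve-∀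

-- Splits off the last term of the convolution, where computation splits off the first. `*ˢ-comm`
-- needs this because exchanging the factors exchanges the two ends.
*ˢ-sucʳ : ∀ f g n → (f *ˢ g) (suc n) ≡ (f *ˢ (g ∘ suc)) n ℤ.+ f (suc n) ℤ.* g 0
*ˢ-sucʳ f g zero    = lemma (f 0) (g 1) (f 1) (g 0)
  where
  lemma : ∀ w x y z → w ℤ.* x ℤ.+ (y ℤ.* z ℤ.+ 0ℤ) ≡ w ℤ.* x ℤ.+ 0ℤ ℤ.+ y ℤ.* z
  lemma = solve-∀
*ˢ-sucʳ f g (suc n) = trans
  (cong (λ t → f 0 ℤ.* g (suc (suc n)) ℤ.+ t) (*ˢ-sucʳ (f ∘ suc) g n))
  (sym (ℤ.+-assoc (f 0 ℤ.* g (suc (suc n))) _ _))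

*ˢ-comm : ∀ f g → f *ˢ g ≗ g *ˢ f
*ˢ-comm f g zero    = cong (ℤ._+ 0ℤ) (ℤ.*-comm (f 0) (g 0))
*ˢ-comm f g (suc n) = begin
  f 0 ℤ.* g (suc n) ℤ.+ ((f ∘ suc) *ˢ g) n  ≡⟨ ℤ.+-comm (f 0 ℤ.* g (suc n)) _ ⟩
  ((f ∘ suc) *ˢ g) n ℤ.+ f 0 ℤ.* g (suc n)  ≡⟨ cong₂ ℤ._+_ (*ˢ-comm (f ∘ suc) g n) (ℤ.*-comm (f 0) (g (suc n))) ⟩
  (g *ˢ (f ∘ suc)) n ℤ.+ g (suc n) ℤ.* f 0  ≡⟨ *ˢ-sucʳ g f n ⟨
  (g *ˢ f) (suc n)                          ∎
  where open ≡-Reasoning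

ℤ[[q]]-commutativeRing : CommutativeRing 0ℓ 0ℓ
ℤ[[q]]-commutativeRing = record
  { Carrier           = ℤ[[q]]
  ; _≈_               = _≗_
  ; _+_               = _+ˢ_
  ; _*_               = _*ˢ_
  ; -_                = -ˢ_
  ; 0#                = 0ˢ
  ; 1#                = 1ˢ
  ; isCommutativeRing = record
    { isRing = record
      { +-isAbelianGroup = Pointwise.isAbelianGroup ℕ ℤ.+-0-isAbelianGroup
      ; *-cong           = *ˢ-cong
      ; *-assoc          = *ˢ-assoc
      ; *-identity       = *ˢ-identityˡ , λ f n → trans (*ˢ-comm f 1ˢ n) (*ˢ-identityˡ f n)
      ; distrib          = *ˢ-distribˡ-+ˢ , *ˢ-distribʳ-+ˢ
      }
    ; *-comm = *ˢ-comm
    }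
  }
  where
  *ˢ-distribˡ-+ˢ : ∀ h f g → h *ˢ (f +ˢ g) ≗ h *ˢ f +ˢ h *ˢ g
  *ˢ-distribˡ-+ˢ h f g n = trans (*ˢ-comm h (f +ˢ g) n)
    (trans (*ˢ-distribʳ-+ˢ h f g n) (cong₂ ℤ._+_ (*ˢ-comm f h n) (*ˢ-comm g h n)))

module R where
  open CommutativeRing ℤ[[q]]-commutativeRing public
  open RingProperties ring public
  open CommutativeSemigroupProperties *-commutativeSemigroup public using (interchange)

module ≗-Reasoning = SetoidReasoning R.setoid

-- For `z` a positive power of `q`, the inverse of `1ˢ +ˢ z` has negative coefficients; multiplying
-- by the matching factor `1ˢ -ˢ z` removes this obstacle.
[1+z][1-z]≗1-z² : ∀ z → (1ˢ +ˢ z) *ˢ (1ˢ -ˢ z) ≗ 1ˢ -ˢ z *ˢ z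
[1+z][1-z]≗1-z² z = begin
  (1ˢ +ˢ z) *ˢ (1ˢ -ˢ z)                 ≈⟨ R.distribʳ (1ˢ -ˢ z) 1ˢ z ⟩
  1ˢ *ˢ (1ˢ -ˢ z) +ˢ z *ˢ (1ˢ -ˢ z)      ≈⟨ R.+-cong (R.*-identityˡ (1ˢ -ˢ z)) (R.distribˡ z 1ˢ (-ˢ z)) ⟩
  1ˢ -ˢ z +ˢ (z *ˢ 1ˢ +ˢ z *ˢ (-ˢ z))    ≈⟨ R.+-congˡ {1ˢ -ˢ z} (R.+-cong (R.*-identityʳ z) (R.sym (R.-‿distribʳ-* z z))) ⟩
  1ˢ -ˢ z +ˢ (z -ˢ z *ˢ z)               ≈⟨ (λ n → lemma (1ˢ n) (z n) ((z *ˢ z) n)) ⟩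
  1ˢ -ˢ z *ˢ z                           ∎
  where
  open ≗-Reasoning
  lemma : ∀ x y s → x ℤ.- y ℤ.+ (y ℤ.- s) ≡ x ℤ.- s
  lemma = solve-∀

-- With `w = p ^ˢ i`, the left side is the form in which a factor of `⟨ -ˢ z ⨾ p ⟩ n` unfolds; the
-- right side makes its signs visible.
1-[-z]w≗1+zw : ∀ z w → 1ˢ -ˢ (-ˢ z) *ˢ w ≗ 1ˢ +ˢ z *ˢ w
1-[-z]w≗1+zw z w n = cong (λ t → 1ˢ n ℤ.+ t)
  (trans (cong ℤ.-_ (sym (R.-‿distribˡ-* z w n))) (ℤ.neg-involutive _))

-- Non-negative coefficients

0≤i*j : ∀ {i j} → 0ℤ ℤ.≤ i → 0ℤ ℤ.≤ j → 0ℤ ℤ.≤ i ℤ.* j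
0≤i*j {i} {j} 0≤i 0≤j = ℤ.*-monoʳ-≤-nonNeg j {{nonNegative 0≤j}} 0≤i

∈ℕ₀-resp-≗ : ∀ {f g} → f ≗ g → f ∈ℕ₀[[q]] → g ∈ℕ₀[[q]]
∈ℕ₀-resp-≗ f≗g f≥0 n = subst (0ℤ ℤ.≤_) (f≗g n) (f≥0 n)

+ˢ-∈ℕ₀ : ∀ {f g} → f ∈ℕ₀[[q]] → g ∈ℕ₀[[q]] → f +ˢ g ∈ℕ₀[[q]]
+ˢ-∈ℕ₀ f≥0 g≥0 n = ℤ.+-mono-≤ (f≥0 n) (g≥0 n)

*ˢ-∈ℕ₀ : ∀ {f g} → f ∈ℕ₀[[q]] → g ∈ℕ₀[[q]] → f *ˢ g ∈ℕ₀[[q]]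
*ˢ-∈ℕ₀ f≥0 g≥0 zero    = ℤ.+-mono-≤ (0≤i*j (f≥0 0) (g≥0 0)) ℤ.≤-refl
*ˢ-∈ℕ₀ f≥0 g≥0 (suc n) =
  ℤ.+-mono-≤ (0≤i*j (f≥0 0) (g≥0 (suc n))) (*ˢ-∈ℕ₀ (f≥0 ∘ suc) g≥0 n)

1ˢ-∈ℕ₀ : 1ˢ ∈ℕ₀[[q]]
1ˢ-∈ℕ₀ zero    = +≤+ z≤n
1ˢ-∈ℕ₀ (suc _) = ℤ.≤-refl

q-∈ℕ₀ : q ∈ℕ₀[[q]]
q-∈ℕ₀ zero          = ℤ.≤-refl
q-∈ℕ₀ (suc zero)    = +≤+ z≤n
q-∈ℕ₀ (suc (suc _)) = ℤ.≤-refl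

^ˢ-∈ℕ₀ : ∀ {f} → f ∈ℕ₀[[q]] → ∀ n → f ^ˢ n ∈ℕ₀[[q]]
^ˢ-∈ℕ₀ f≥0 zero    = 1ˢ-∈ℕ₀
^ˢ-∈ℕ₀ f≥0 (suc n) = *ˢ-∈ℕ₀ f≥0 (^ˢ-∈ℕ₀ f≥0 n)

⟨-z⨾p⟩-∈ℕ₀ : ∀ {z p} → z ∈ℕ₀[[q]] → p ∈ℕ₀[[q]] → ∀ n → ⟨ -ˢ z ⨾ p ⟩ n ∈ℕ₀[[q]]
⟨-z⨾p⟩-∈ℕ₀ z≥0 p≥0 zero    = 1ˢ-∈ℕ₀
⟨-z⨾p⟩-∈ℕ₀ {z} {p} z≥0 p≥0 (suc n) = *ˢ-∈ℕ₀ (⟨-z⨾p⟩-∈ℕ₀ z≥0 p≥0 n)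
  (∈ℕ₀-resp-≗ (R.sym (1-[-z]w≗1+zw z (p ^ˢ n)))
    (+ˢ-∈ℕ₀ 1ˢ-∈ℕ₀ (*ˢ-∈ℕ₀ z≥0 (^ˢ-∈ℕ₀ p≥0 n))))

-- One step of long division by `1ˢ -ˢ y` leaves a dividend with coefficients
-- `f (suc m) + f 0 * y (suc m)`, again non-negative. Since the dividend changes, the induction is
-- over all `f`.
/ˢ[1-y]-∈ℕ₀ : ∀ {y} → y ∈ℕ₀[[q]] → ∀ f → f ∈ℕ₀[[q]] → f /ˢ (1ˢ -ˢ y) ∈ℕ₀[[q]]
/ˢ[1-y]-∈ℕ₀ y≥0 f f≥0 zero    = f≥0 0
/ˢ[1-y]-∈ℕ₀ {y} y≥0 f f≥0 (suc n) = /ˢ[1-y]-∈ℕ₀ y≥0 _ remainder≥0 n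
  where
  -- `0ℤ - c` is what the coefficient of `1ˢ -ˢ y` at `suc m` computes to, with `c = y (suc m)`.
  lemma : ∀ a b c → a ℤ.+ b ℤ.* c ≡ a ℤ.- b ℤ.* (0ℤ ℤ.- c)
  lemma = solve-∀
  remainder≥0 : (λ m → f (suc m) ℤ.- f 0 ℤ.* (0ℤ ℤ.- y (suc m))) ∈ℕ₀[[q]]
  remainder≥0 m = subst (0ℤ ℤ.≤_) (lemma (f (suc m)) (f 0) (y (suc m)))
    (ℤ.+-mono-≤ (f≥0 (suc m)) (0≤i*j (f≥0 0) (y≥0 (suc m))))

-- Series with a non-negative inverse

-- An explicit inverse is used instead of `/ˢ` so that closure under products follows from the ring
-- laws and `*ˢ-∈ℕ₀`.
ℕ₀-Invertible : ℤ[[q]] → Set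
ℕ₀-Invertible g = ∃ λ r → r ∈ℕ₀[[q]] × r *ˢ g ≗ 1ˢ

ℕ₀-invertible-resp-≗ : ∀ {f g} → f ≗ g → ℕ₀-Invertible f → ℕ₀-Invertible g
ℕ₀-invertible-resp-≗ f≗g (r , r≥0 , rf≗1) =
  r , r≥0 , R.trans (R.*-congˡ {r} (R.sym f≗g)) rf≗1

1ˢ-ℕ₀-invertible : ℕ₀-Invertible 1ˢ
1ˢ-ℕ₀-invertible = 1ˢ , 1ˢ-∈ℕ₀ , R.*-identityˡ 1ˢ

*ˢ-ℕ₀-invertible : ∀ {f g} → ℕ₀-Invertible f → ℕ₀-Invertible g → ℕ₀-Invertible (f *ˢ g)
*ˢ-ℕ₀-invertible {f} {g} (r , r≥0 , rf≗1) (s , s≥0 , sg≗1) = r *ˢ s , *ˢ-∈ℕ₀ r≥0 s≥0 , (begin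
  (r *ˢ s) *ˢ (f *ˢ g)  ≈⟨ R.interchange r s f g ⟩
  (r *ˢ f) *ˢ (s *ˢ g)  ≈⟨ R.*-cong rf≗1 sg≗1 ⟩
  1ˢ *ˢ 1ˢ              ≈⟨ R.*-identityˡ 1ˢ ⟩
  1ˢ                    ∎)
  where open ≗-Reasoning

-- `y 0 ≡ 0ℤ` gives the divisor constant term 1, so that `/ˢ-correct` turns the long division of
-- `1ˢ` into an inverse.
1-y-ℕ₀-invertible : ∀ {y} → y ∈ℕ₀[[q]] → y 0 ≡ 0ℤ → ℕ₀-Invertible (1ˢ -ˢ y)
1-y-ℕ₀-invertible {y} y≥0 y₀ =
  1ˢ /ˢ (1ˢ -ˢ y) ,
  /ˢ[1-y]-∈ℕ₀ y≥0 1ˢ 1ˢ-∈ℕ₀ ,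
  /ˢ-correct 1ˢ (1ˢ -ˢ y) (cong (λ t → 1ℤ ℤ.- t) y₀)

-- Multiplying `(f /ˢ g) *ˢ g ≗ f` by the inverse `r` identifies the quotient with `f *ˢ r`.
/ˢ-∈ℕ₀ : ∀ {f g} → g 0 ≡ 1ℤ → ℕ₀-Invertible g → f ∈ℕ₀[[q]] → f /ˢ g ∈ℕ₀[[q]]
/ˢ-∈ℕ₀ {f} {g} g₀ (r , r≥0 , rg≗1) f≥0 = ∈ℕ₀-resp-≗ (begin
  f *ˢ r                ≈⟨ R.*-congʳ {r} (/ˢ-correct f g g₀) ⟨
  ((f /ˢ g) *ˢ g) *ˢ r  ≈⟨ R.*-assoc (f /ˢ g) g r ⟩
  (f /ˢ g) *ˢ (g *ˢ r)  ≈⟨ R.*-congˡ {f /ˢ g} (R.trans (R.*-comm g r) rg≗1) ⟩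
  (f /ˢ g) *ˢ 1ˢ        ≈⟨ R.*-identityʳ (f /ˢ g) ⟩
  f /ˢ g                ∎) (*ˢ-∈ℕ₀ f≥0 r≥0)
  where open ≗-Reasoning

-- Invertibility of the denominator

module _ {x p} (x≥0 : x ∈ℕ₀[[q]]) (p≥0 : p ∈ℕ₀[[q]]) (x₀ : x 0 ≡ 0ℤ) where

  private
    -- Chosen so that `1ˢ -ˢ z i` is definitionally the factor of index `i` in `⟨ x ⨾ p ⟩`.
    z : ℕ → ℤ[[q]]
    z i = x *ˢ p ^ˢ i

    z≥0 : ∀ i → z i ∈ℕ₀[[q]]
    z≥0 i = *ˢ-∈ℕ₀ x≥0 (^ˢ-∈ℕ₀ p≥0 i)

    z₀ : ∀ i → z i 0 ≡ 0ℤ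
    z₀ i = trans (*ˢ-constant x (p ^ˢ i)) (cong (ℤ._* (p ^ˢ i) 0) x₀)

  -- Going from `n` to `suc n` adds one factor to each product; `interchange` brings the two
  -- together as `1ˢ -ˢ z n *ˢ z n`.
  paired-ℕ₀-invertible : ∀ n → ℕ₀-Invertible ((⟨ -ˢ x ⨾ p ⟩ n) *ˢ (⟨ x ⨾ p ⟩ n))
  paired-ℕ₀-invertible zero    = *ˢ-ℕ₀-invertible 1ˢ-ℕ₀-invertible 1ˢ-ℕ₀-invertible
  paired-ℕ₀-invertible (suc n) = ℕ₀-invertible-resp-≗
    (begin
      (A *ˢ B) *ˢ (1ˢ -ˢ z n *ˢ z n)                        ≈⟨ R.*-congˡ {A *ˢ B} ([1+z][1-z]≗1-z² (z n)) ⟨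
      (A *ˢ B) *ˢ ((1ˢ +ˢ z n) *ˢ (1ˢ -ˢ z n))              ≈⟨ R.interchange A B (1ˢ +ˢ z n) (1ˢ -ˢ z n) ⟩
      (A *ˢ (1ˢ +ˢ z n)) *ˢ (B *ˢ (1ˢ -ˢ z n))              ≈⟨ R.*-congʳ {B *ˢ (1ˢ -ˢ z n)} (R.*-congˡ {A} (1-[-z]w≗1+zw x (p ^ˢ n))) ⟨
      (A *ˢ (1ˢ -ˢ (-ˢ x) *ˢ p ^ˢ n)) *ˢ (B *ˢ (1ˢ -ˢ z n))  ∎)
    (*ˢ-ℕ₀-invertible (paired-ℕ₀-invertible n)
      (1-y-ℕ₀-invertible (*ˢ-∈ℕ₀ (z≥0 n) (z≥0 n))
        (trans (*ˢ-constant (z n) (z n)) (cong (ℤ._* z n 0) (z₀ n)))))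
    where
    open ≗-Reasoning
    A B : ℤ[[q]]
    A = ⟨ -ˢ x ⨾ p ⟩ n
    B = ⟨ x ⨾ p ⟩ n

  -- Induction on `n ≤′ m` starts from products of equal length and appends the surplus factors of
  -- the second one at a time, on the right.
  denominator-ℕ₀-invertible : ∀ {n m} → n ≤′ m →
    ℕ₀-Invertible ((⟨ -ˢ x ⨾ p ⟩ n) *ˢ (⟨ x ⨾ p ⟩ m))
  denominator-ℕ₀-invertible {n} ≤′-refl               = paired-ℕ₀-invertible n
  denominator-ℕ₀-invertible {n} (≤′-step {n = m} n≤m) = ℕ₀-invertible-resp-≗
    (R.*-assoc (⟨ -ˢ x ⨾ p ⟩ n) (⟨ x ⨾ p ⟩ m) (1ˢ -ˢ z m))
    (*ˢ-ℕ₀-invertible (denominator-ℕ₀-invertible n≤m) (1-y-ℕ₀-invertible (z≥0 m) (z₀ m)))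

theorem3p2 : ∀ (a N M : ℕ) .{{_ : NonZero a}} .{{_ : NonZero N}} .{{_ : NonZero M}} →
    N ≤ M →
    (⟨ -ˢ (q ^ˢ (2 * a)) ⨾ q ^ˢ (2 * a) ⟩ (N + M ∸ 1))
    /ˢ ((⟨ -ˢ (q ^ˢ a) ⨾ q ^ˢ (2 * a) ⟩ N) *ˢ (⟨ q ^ˢ a ⨾ q ^ˢ (2 * a) ⟩ M))
    ∈ℕ₀[[q]]
theorem3p2 a N M N≤M = /ˢ-∈ℕ₀
  (denominator-constant a N M)
  (denominator-ℕ₀-invertible (^ˢ-∈ℕ₀ q-∈ℕ₀ a) q²ᵃ≥0 (q^-constant a) (≤⇒≤′ N≤M))
  -- In the numerator, `q ^ˢ (2 * a)` is both the negated base and the ratio, hence the repeated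
  -- argument.
  (⟨-z⨾p⟩-∈ℕ₀ q²ᵃ≥0 q²ᵃ≥0 (N + M ∸ 1))
  where
  q²ᵃ≥0 : q ^ˢ (2 * a) ∈ℕ₀[[q]]
  q²ᵃ≥0 = ^ˢ-∈ℕ₀ q-∈ℕ₀ (2 * a)
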